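{- Let $p\ge 1$, let $C_n$ be a cycle on $n$ vertices, let $\lambda$ be a $p$-periodic 1-labeling of $C_n$, and let $\mathcal{C}=(C_n,\lambda)$. Then $1\le M_p(\mathcal{C})\le 2$.
   Context: A $p$-periodic 1-labeling $\lambda$ of a finite simple undirected graph $G=(V,E)$ assigns to each edge $e$ an infinite set of time-steps of the form $\{i,i+p,i+2p,\dots\}$ with $i\in\{1,\dots,p\}$ (so each edge is present exactly once in every $p$ consecutive time-steps). In the temporal graph $\mathcal{G}=(G,\lambda)$, a journey from $u$ to $v$ is a path in $G$ from $u$ to $v$ together with a choice, for each edge of the path, of a time-step in its label set so that the chosen time-steps are strictly increasing along the path. The temporal distance $\mathrm{dist}_t(u,v)$ is the smallest time-step at which a journey from $u$ reaches $v$ (with $\mathrm{dist}_t(u,u)=0$, and $\infty$ if there is no journey). A set $R\subseteq V$ is a temporal resolving set if (i) for every $v\in V$ there is a journey from some $s\in R$ to $v$ (every vertex is reached from itself), and (ii) for every two distinct $u,v\in V$ there is $s\in R$ with $\mathrm{dist}_t(s,u)\neq\mathrm{dist}_t(s,v)$. $M_p(\mathcal{G})$ denotes the minimum size of a temporal resolving set of $\mathcal{G}$. -}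

module Defs where

open import Level using (0ℓ)
open import Data.Nat using (ℕ; suc; _+_; _*_; _≤_; _<_; s≤s)
open import Data.Nat.Properties using (1+n≢n)
open import Data.Fin using (Fin; toℕ)
open import Data.Fin.Subset using (Subset; _∈_; ∣_∣)
open import Data.List using (List; []; _∷_; last)
open import Data.List.Relation.Binary.Pointwise using (Pointwise)
open import Data.List.Relation.Unary.Linked using (Linked)
open import Data.List.Relation.Unary.Unique.Propositional using (Unique)
open import Data.Maybe using (fromMaybe)
open import Data.Product using (∃-syntax; _×_; _,_)
open import Data.Sum using (_⊎_; inj₁; inj₂; swap)
open import Relation.Binary using (Rel; Symmetric; Irreflexive)
open import Relation.Binary.Construct.Closure.ReflexiveTransitive using (Star; ε; _◅_)
open import Relation.Binary.PropositionalEquality using (_≡_; _≢_; refl; sym)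
open import Relation.Nullary using (¬_)
open import Relation.Nullary.Construct.Add.Supremum using (_⁺; ⊤⁺; [_])
open import Relation.Unary using (Pred; _≐_)

record Graph (n : ℕ) : Set₁ where
  field
    Adj    : Rel (Fin n) 0ℓ
    symm   : Symmetric Adj
    irrefl : Irreflexive _≡_ Adj

module _ {n : ℕ} where

  CyclicSuccessor : Rel (Fin n) 0ℓ
  CyclicSuccessor u v = toℕ v ≡ suc (toℕ u) ⊎ (suc (toℕ u) ≡ n × toℕ v ≡ 0)

  cycleAdj : Rel (Fin n) 0ℓ
  cycleAdj u v = CyclicSuccessor u v ⊎ CyclicSuccessor v u

  CyclicSuccessor-irrefl : 3 ≤ n → ∀ u → ¬ CyclicSuccessor u u
  CyclicSuccessor-irrefl _ u (inj₁ eq) = 1+n≢n (sym eq)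
  CyclicSuccessor-irrefl 3≤n u (inj₂ (eq , z)) rewrite z | sym eq with 3≤n
  ... | s≤s ()

-- A simple graph has a cycle on n vertices only for n ≥ 3.
cycle : ∀ n → 3 ≤ n → Graph n
cycle n 3≤n = record
  { Adj    = cycleAdj
  ; symm   = swap
  ; irrefl = λ { {u} refl (inj₁ s) → CyclicSuccessor-irrefl 3≤n u s
               ; {u} refl (inj₂ s) → CyclicSuccessor-irrefl 3≤n u s }
  }

-- The set of time-steps of the edge uv is  times u v ; values at non-adjacent
-- pairs are irrelevant.
record Labeling {n : ℕ} (G : Graph n) : Set₁ where
  open Graph G
  field
    times      : Fin n → Fin n → Pred ℕ 0ℓ
    undirected : ∀ {u v} → Adj u v → times u v ≐ times v u

IsPeriodic1Labeling : ∀ {n} {G : Graph n} → ℕ → Labeling G → Set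
IsPeriodic1Labeling {G = G} p ℓ =
  ∀ {u v} → Adj u v →
  ∃[ i ] 1 ≤ i × i ≤ p × (times u v ≐ λ t → ∃[ k ] t ≡ i + k * p)
  where
  open Graph G
  open Labeling ℓ

record TemporalGraph (n : ℕ) : Set₁ where
  constructor ⟨_,_⟩
  field
    graph    : Graph n
    labeling : Labeling graph
  open Graph graph public
  open Labeling labeling public

module _ {n : ℕ} (𝒢 : TemporalGraph n) where
  open TemporalGraph 𝒢

  Walk : Rel (Fin n) 0ℓ
  Walk = Star Adj

  vertices : ∀ {u v} → Walk u v → List (Fin n)
  vertices {u} ε       = u ∷ []
  vertices {u} (_ ◅ w) = u ∷ vertices w

  edges : ∀ {u v} → Walk u v → List (Fin n × Fin n)
  edges ε                         = []
  edges (_◅_ {i = u} {j = v} _ w) = (u , v) ∷ edges w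

  record Journey (u v : Fin n) : Set where
    field
      walk       : Walk u v
      isPath     : Unique (vertices walk)
      steps      : List ℕ
      available  : Pointwise (λ t (x , y) → times x y t) steps (edges walk)
      increasing : Linked _<_ steps

    -- The trivial journey (from u to u) arrives at time 0.
    arrival : ℕ
    arrival = fromMaybe 0 (last steps)

  -- The relation "dist_t(u,v) = d", with d in ℕ ∪ {∞}.
  TemporalDistance : Fin n → Fin n → ℕ ⁺ → Set
  TemporalDistance u v [ t ] =
    (∃[ J ] Journey.arrival {u} {v} J ≡ t) × (∀ (J : Journey u v) → t ≤ Journey.arrival J)
  TemporalDistance u v ⊤⁺ = ¬ Journey u v

  Distinguishes : Fin n → Fin n → Fin n → Set
  Distinguishes s u v =
    ∃[ d ] ∃[ e ] TemporalDistance s u d × TemporalDistance s v e × d ≢ e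

  record IsTemporalResolvingSet (R : Subset n) : Set where
    field
      reaches  : ∀ v → ∃[ s ] s ∈ R × Journey s v
      resolves : ∀ u v → u ≢ v → ∃[ s ] s ∈ R × Distinguishes s u v

  -- The relation "m is the minimum size of a temporal resolving set".
  IsTemporalMetricDimension : ℕ → Set
  IsTemporalMetricDimension m =
    (∃[ R ] IsTemporalResolvingSet R × ∣ R ∣ ≡ m) ×
    (∀ R → IsTemporalResolvingSet R → m ≤ ∣ R ∣)

{-# OPTIONS --safe #-}

-- Going clockwise around the cycle the labels cannot increase forever, so some
-- edge from t = σ s to σ t has a label at most that of the edge from s to t; then
-- { s , t } is resolving.  Let s not separate u and v, with u met before v when
-- going clockwise from s.  Along each of the two directions arrival times
-- increase strictly, so the distance from s is attained clockwise at u and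
-- counterclockwise at v.  Starting at t instead of s strictly improves the
-- clockwise arrival at u (a journey from s misses the first appearance of the
-- edge following t, and so lags p steps behind), while the counterclockwise
-- arrival at v does not improve and the clockwise one comes after that at u.
-- Hence t is nearer to u than to v.
module Submission where

open import Defs
open import Data.Bool using (true; false)
open import Data.Fin as Fin using (Fin; toℕ)
open import Data.Fin.Properties as Fin using (toℕ-injective; toℕ-fromℕ<; toℕ<n)
open import Data.Fin.Subset using (Subset; _∈_; ∣_∣; ⁅_⁆; _∪_)
open import Data.Fin.Subset.Properties
open import Data.List using (List; []; _∷_; last)
open import Data.List.Relation.Binary.Pointwise using (Pointwise; []; _∷_)
open import Data.List.Relation.Unary.All using (All; []; _∷_)
open import Data.List.Relation.Unary.AllPairs using ([]; _∷_)
open import Data.List.Relation.Unary.Linked as Linked using (Linked; [-]; _∷_)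
open import Data.List.Relation.Unary.Unique.Propositional using (Unique)
open import Data.Maybe using (fromMaybe)
open import Data.Nat using (ℕ; zero; suc; pred; _+_; _*_; _∸_; _⊓_; _≤_; _<_; z≤n; s≤s; z<s; s<s⁻¹;
  _≟_; _≤?_; NonZero; >-nonZero)
open import Data.Nat.DivMod
open import Data.Nat.GeneralisedArithmetic using (iterate)
open import Data.Nat.Properties
open import Data.Product using (∃-syntax; _×_; _,_; proj₁; proj₂)
open import Data.Sum as Sum using (_⊎_; inj₁; inj₂)
open import Data.Vec using ([]; _∷_)
open import Function using (_∘_)
open import Relation.Binary.Construct.Closure.ReflexiveTransitive using (ε; _◅_)
open import Relation.Binary.Definitions using (tri<; tri≈; tri>)
open import Relation.Binary.PropositionalEquality
open import Relation.Nullary using (¬_; Dec; yes; no; contradiction; ¬?)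
open import Relation.Nullary.Decidable using (_→-dec_)
open import Relation.Nullary.Construct.Add.Supremum using (⊤⁺; [_]; []-injective)

-- Auxiliary facts on iteration, lists and sizes of subsets.

iterate-suc : ∀ {A : Set} (f : A → A) x k → iterate f x (suc k) ≡ f (iterate f x k)
iterate-suc f x zero    = refl
iterate-suc f x (suc k) = iterate-suc f (f x) k

last-∷ : ∀ {A : Set} (y x : A) xs → fromMaybe y (last (x ∷ xs)) ≡ fromMaybe x (last xs)
last-∷ y x []            = refl
last-∷ y x (z ∷ [])      = refl
last-∷ y x (z ∷ z′ ∷ zs) = last-∷ y x (z′ ∷ zs)

∣p∪q∣≤∣p∣+∣q∣ : ∀ {n} (p q : Subset n) → ∣ p ∪ q ∣ ≤ ∣ p ∣ + ∣ q ∣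
∣p∪q∣≤∣p∣+∣q∣ []          []          = z≤n
∣p∪q∣≤∣p∣+∣q∣ (false ∷ p) (false ∷ q) = ∣p∪q∣≤∣p∣+∣q∣ p q
∣p∪q∣≤∣p∣+∣q∣ (false ∷ p) (true ∷ q)  rewrite +-suc ∣ p ∣ ∣ q ∣ = s≤s (∣p∪q∣≤∣p∣+∣q∣ p q)
∣p∪q∣≤∣p∣+∣q∣ (true ∷ p)  (false ∷ q) = s≤s (∣p∪q∣≤∣p∣+∣q∣ p q)
∣p∪q∣≤∣p∣+∣q∣ (true ∷ p)  (true ∷ q)  = s≤s (≤-trans (∣p∪q∣≤∣p∣+∣q∣ p q) (+-monoʳ-≤ ∣ p ∣ (n≤1+n ∣ q ∣)))

x∈p⇒1≤∣p∣ : ∀ {n} {p : Subset n} {x} → x ∈ p → 1 ≤ ∣ p ∣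
x∈p⇒1≤∣p∣ x∈p = ≤-trans z<s (x∈p⇒∣p-x∣<∣p∣ x∈p)

x≢y⇒2≤∣p∣ : ∀ {n} {p : Subset n} {x y} → x ∈ p → y ∈ p → x ≢ y → 2 ≤ ∣ p ∣
x≢y⇒2≤∣p∣ x∈p y∈p x≢y =
  ≤-<-trans (x∈p⇒1≤∣p∣ (x∈p∧x≢y⇒x∈p-y x∈p x≢y)) (x∈p⇒∣p-x∣<∣p∣ y∈p)

-- Induction on `t`: the answer for `t` still serves for `suc t` unless it equals `suc t`, and then
-- the appearance one period later takes over.
earliest : ∀ {p l} → 1 ≤ p → 1 ≤ l → ∀ t →
  ∃[ u ] t < u × (∃[ k ] u ≡ l + k * p) × (∀ k → t < l + k * p → u ≤ l + k * p)
earliest {p} {l} 1≤p 1≤l zero = l , 1≤l , (0 , sym (+-identityʳ l)) , λ k _ → m≤m+n l (k * p)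
earliest {p} {l} 1≤p 1≤l (suc t) with earliest {p} 1≤p 1≤l t
... | u , t<u , (k , u≡) , least with u ≟ suc t
...   | no u≢ = u , ≤∧≢⇒< t<u (u≢ ∘ sym) , (k , u≡) , λ j t<j → least j (<-trans (n<1+n t) t<j)
...   | yes u≡1+t = l + suc k * p , <-later , (suc k , refl) , least′
  where
  1+t≡ : suc t ≡ l + k * p
  1+t≡ = trans (sym u≡1+t) u≡

  <-later : suc t < l + suc k * p
  <-later rewrite 1+t≡ = +-monoʳ-< l (m<n+m (k * p) 1≤p)

  least′ : ∀ j → suc t < l + j * p → l + suc k * p ≤ l + j * p
  least′ j 1+t<j = +-monoʳ-≤ l (*-monoˡ-≤ p
    (*-cancelʳ-< p k j (+-cancelˡ-< l (k * p) (j * p) (subst (_< l + j * p) 1+t≡ 1+t<j))))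

module _ {n : ℕ} (𝒢 : TemporalGraph n) where

  TemporalDistance-unique : ∀ {s v t} → TemporalDistance 𝒢 s v [ t ] →
    ∀ d → TemporalDistance 𝒢 s v d → d ≡ [ t ]
  TemporalDistance-unique ((J , J≡t) , t≤) [ t′ ] ((J′ , J′≡t′) , t′≤) =
    cong [_] (≤-antisym (subst (t′ ≤_) J≡t (t′≤ J)) (subst (_ ≤_) J′≡t′ (t≤ J′)))
  TemporalDistance-unique ((J , _) , _) ⊤⁺ ¬J = contradiction J ¬J

  <⇒Distinguishes : ∀ {s u v d e} → TemporalDistance 𝒢 s u [ d ] →
    TemporalDistance 𝒢 s v [ e ] → d < e → Distinguishes 𝒢 s u v
  <⇒Distinguishes du dv d<e = _ , _ , du , dv , <⇒≢ d<e ∘ []-injective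

  Distinguishes-sym : ∀ {s u v} → Distinguishes 𝒢 s u v → Distinguishes 𝒢 s v u
  Distinguishes-sym (d , e , du , dv , d≢e) = e , d , dv , du , d≢e ∘ sym

-- Arrival times when the vertices v, σ v, σ (σ v), … are visited as early as possible.
module Ray {n p : ℕ} (𝒢 : TemporalGraph n)
           (periodic : IsPeriodic1Labeling p (TemporalGraph.labeling 𝒢))
           (σ : Fin n → Fin n) (σ-adj : ∀ v → TemporalGraph.Adj 𝒢 v (σ v)) where

  open TemporalGraph 𝒢

  label : Fin n → ℕ
  label v = proj₁ (periodic (σ-adj v))

  1≤label : ∀ v → 1 ≤ label v
  1≤label v = proj₁ (proj₂ (periodic (σ-adj v)))

  label≤p : ∀ v → label v ≤ p
  label≤p v = proj₁ (proj₂ (proj₂ (periodic (σ-adj v))))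

  private
    next : ∀ v t → ∃[ u ] t < u × (∃[ k ] u ≡ label v + k * p) ×
                   (∀ k → t < label v + k * p → u ≤ label v + k * p)
    next v = earliest (≤-trans (1≤label v) (label≤p v)) (1≤label v)

  -- First appearance of the edge from `v` to `σ v` strictly after `t`; strict, since the time-steps
  -- of a journey strictly increase.
  crossing : Fin n → ℕ → ℕ
  crossing v t = proj₁ (next v t)

  t<crossing : ∀ v t → t < crossing v t
  t<crossing v t = proj₁ (proj₂ (next v t))

  crossing-form : ∀ v t → ∃[ k ] crossing v t ≡ label v + k * p
  crossing-form v t = proj₁ (proj₂ (proj₂ (next v t)))

  crossing-available : ∀ v t → times v (σ v) (crossing v t)
  crossing-available v t = proj₂ (proj₂ (proj₂ (proj₂ (periodic (σ-adj v))))) (crossing-form v t)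

  crossing-least : ∀ {v t u} → times v (σ v) u → t < u → crossing v t ≤ u
  crossing-least {v} {t} u∈ t<u with proj₁ (proj₂ (proj₂ (proj₂ (periodic (σ-adj v))))) u∈
  ... | k , refl = proj₂ (proj₂ (proj₂ (next v t))) k t<u

  label≤crossing : ∀ v t → label v ≤ crossing v t
  label≤crossing v t with crossing v t | crossing-form v t
  ... | _ | k , refl = m≤m+n (label v) (k * p)

  crossing-mono-≤ : ∀ v {t t′} → t ≤ t′ → crossing v t ≤ crossing v t′
  crossing-mono-≤ v {t′ = t′} t≤t′ =
    crossing-least (crossing-available v t′) (≤-<-trans t≤t′ (t<crossing v t′))

  -- By time `t` the first appearance has passed, so the crossing has an appearance one period
  -- before it; `k` indexes that one.
  crossing-previous : ∀ v t → label v ≤ t → ∃[ k ] crossing v t ≡ label v + k * p + p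
  crossing-previous v t l≤t with crossing v t | t<crossing v t | crossing-form v t
  ... | _ | t<c | zero , refl =
    contradiction (subst (t <_) (+-identityʳ (label v)) t<c) (≤⇒≯ l≤t)
  ... | _ | t<c | suc k , refl =
    k , trans (cong (label v +_) (+-comm p (k * p))) (sym (+-assoc (label v) (k * p) p))

  -- The appearance one period before `crossing v t′` still lies after `t`, hence bounds
  -- `crossing v t`. A lag of a full period thus survives every edge.
  crossing-lag : ∀ v {t t′} → t + p ≤ t′ → crossing v t + p ≤ crossing v t′
  crossing-lag v {t} {t′} t+p≤t′
    with crossing-previous v t′ (≤-trans (label≤p v) (≤-trans (m≤n+m p t) t+p≤t′))
  ... | k , eq rewrite eq = +-monoˡ-≤ p (proj₂ (proj₂ (proj₂ (next v t))) k
    (+-cancelʳ-< p t (label v + k * p) (≤-<-trans t+p≤t′ (subst (t′ <_) eq (t<crossing v t′)))))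

  -- This is where a lag originates: at time `t` the first appearance is already missed, while from
  -- time 0 it can be caught.
  crossing-lag₀ : ∀ v {t} → label v ≤ t → crossing v 0 + p ≤ crossing v t
  crossing-lag₀ v {t} l≤t with crossing-previous v t l≤t
  ... | k , eq rewrite eq = +-monoˡ-≤ p (proj₂ (proj₂ (proj₂ (next v 0))) k
    (≤-trans (1≤label v) (m≤m+n (label v) (k * p))))

  arrive : Fin n → ℕ → ℕ → ℕ
  arrive v t zero    = t
  arrive v t (suc k) = arrive (σ v) (crossing v t) k

  -- `arrive` recurses on the first edge; peeling off the last one instead is what extending a walk
  -- at its end requires.
  arrive-suc : ∀ v t k → arrive v t (suc k) ≡ crossing (iterate σ v k) (arrive v t k)
  arrive-suc v t zero    = refl
  arrive-suc v t (suc k) = arrive-suc (σ v) (crossing v t) k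

  arrive-mono-≤ : ∀ v k {t t′} → t ≤ t′ → arrive v t k ≤ arrive v t′ k
  arrive-mono-≤ v zero    t≤t′ = t≤t′
  arrive-mono-≤ v (suc k) t≤t′ = arrive-mono-≤ (σ v) k (crossing-mono-≤ v t≤t′)

  arrive-lag : ∀ v k {t t′} → t + p ≤ t′ → arrive v t k + p ≤ arrive v t′ k
  arrive-lag v zero    lag = lag
  arrive-lag v (suc k) lag = arrive-lag (σ v) k (crossing-lag v lag)

  arrive-<-suc : ∀ v t k → arrive v t k < arrive v t (suc k)
  arrive-<-suc v t zero    = t<crossing v t
  arrive-<-suc v t (suc k) = arrive-<-suc (σ v) (crossing v t) k

  arrive-mono-< : ∀ v t {j k} → j < k → arrive v t j < arrive v t k
  arrive-mono-< v t {zero}  {suc zero}    _   = t<crossing v t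
  arrive-mono-< v t {zero}  {suc (suc k)} _   =
    <-trans (t<crossing v t) (arrive-mono-< (σ v) (crossing v t) {zero} {suc k} z<s)
  arrive-mono-< v t {suc j} {suc k}       j<k = arrive-mono-< (σ v) (crossing v t) (s<s⁻¹ j<k)

  -- From `v`, the vertex `σ v` is reached no earlier than `label v`, so the first appearance of the
  -- next edge is missed. The resulting lag `p` persists, and `p` is positive.
  arrive-σ-< : ∀ v k → label (σ v) ≤ label v → arrive (σ v) 0 k < arrive v 0 (suc k)
  arrive-σ-< v zero    _ = t<crossing v 0
  arrive-σ-< v (suc k) l = <-≤-trans (m<m+n _ (≤-trans (1≤label v) (label≤p v)))
    (arrive-lag (σ (σ v)) k (crossing-lag₀ (σ v) (≤-trans l (label≤crossing v 0))))

  -- Each failed test raises the label by at least one and so preserves `p < fuel + label v`; with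
  -- no fuel left this contradicts `label≤p`.
  descent : ∀ v → ∃[ s ] label (σ s) ≤ label s
  descent v = search p v (m<m+n p (1≤label v))
    where
    search : ∀ fuel v → p < fuel + label v → ∃[ s ] label (σ s) ≤ label s
    search zero       v p< = contradiction (label≤p v) (<⇒≱ p<)
    search (suc fuel) v p< with label (σ v) ≤? label v
    ... | yes l = v , l
    ... | no ¬l = search fuel (σ v)
      (≤-trans p< (≤-trans (≤-reflexive (sym (+-suc fuel (label v)))) (+-monoʳ-≤ fuel (≰⇒> ¬l))))

  -- Journeys realising the arrival times.

  walk : ∀ v k → Walk 𝒢 v (iterate σ v k)
  walk v zero    = ε
  walk v (suc k) = σ-adj v ◅ walk (σ v) k

  steps : Fin n → ℕ → ℕ → List ℕ
  steps v t zero    = []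
  steps v t (suc k) = crossing v t ∷ steps (σ v) (crossing v t) k

  steps-available : ∀ v t k →
    Pointwise (λ u (x , y) → times x y u) (steps v t k) (edges 𝒢 (walk v k))
  steps-available v t zero    = []
  steps-available v t (suc k) = crossing-available v t ∷ steps-available (σ v) (crossing v t) k

  steps-increasing : ∀ v t k → Linked _<_ (t ∷ steps v t k)
  steps-increasing v t zero    = [-]
  steps-increasing v t (suc k) = t<crossing v t ∷ steps-increasing (σ v) (crossing v t) k

  last-steps : ∀ v t k → fromMaybe t (last (steps v t k)) ≡ arrive v t k
  last-steps v t zero    = refl
  last-steps v t (suc k) =
    trans (last-∷ t (crossing v t) (steps (σ v) (crossing v t) k)) (last-steps (σ v) (crossing v t) k)

  vertices-walk : ∀ {P : Fin n → Set} v k → (∀ j → j ≤ k → P (iterate σ v j)) →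
    All P (vertices 𝒢 (walk v k))
  vertices-walk v zero    P! = P! 0 z≤n ∷ []
  vertices-walk v (suc k) P! = P! 0 z≤n ∷ vertices-walk (σ v) k (λ j j≤k → P! (suc j) (s≤s j≤k))

  module _ (aperiodic : ∀ v {j} → 0 < j → j < n → iterate σ v j ≢ v) where

    walk-isPath : ∀ v {k} → k < n → Unique (vertices 𝒢 (walk v k))
    walk-isPath v {zero}  _   = [] ∷ []
    walk-isPath v {suc k} k<n =
      vertices-walk (σ v) k (λ j j≤k → aperiodic v {suc j} z<s (≤-<-trans (s≤s j≤k) k<n) ∘ sym)
      ∷ walk-isPath (σ v) (<-trans (n<1+n k) k<n)

    journey : ∀ v {k} → k < n →
      ∃[ J ] Journey.arrival {𝒢 = 𝒢} {v} {iterate σ v k} J ≡ arrive v 0 k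
    journey v {k} k<n = record
      { walk       = walk v k
      ; isPath     = walk-isPath v k<n
      ; steps      = steps v 0 k
      ; available  = steps-available v 0 k
      ; increasing = Linked.tail (steps-increasing v 0 k)
      } , last-steps v 0 k

-- The rotation of the cycle and its inverse.

module Rotation {n : ℕ} .{{_ : NonZero n}} where

  σ : Fin n → Fin n
  σ v = suc (toℕ v) mod n

  -- The inverse of `σ`, written as a power of it so that both inverse laws follow from `σ-order`.
  τ : Fin n → Fin n
  τ v = iterate σ v (pred n)

  toℕ-σ : ∀ v → toℕ (σ v) ≡ suc (toℕ v) % n
  toℕ-σ v = toℕ-fromℕ< (m%n<n (suc (toℕ v)) n)

  suc-% : ∀ m → suc (m % n) % n ≡ suc m % n
  suc-% m = trans (%-distribˡ-+ 1 (m % n) n)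
    (trans (cong (λ x → (1 % n + x) % n) (m%n%n≡m%n m n)) (sym (%-distribˡ-+ 1 m n)))

  toℕ-iterate-σ : ∀ v k → toℕ (iterate σ v k) ≡ (k + toℕ v) % n
  toℕ-iterate-σ v zero    = sym (m<n⇒m%n≡m (toℕ<n v))
  toℕ-iterate-σ v (suc k) = begin
    toℕ (iterate σ v (suc k))       ≡⟨ cong toℕ (iterate-suc σ v k) ⟩
    toℕ (σ (iterate σ v k))         ≡⟨ toℕ-σ (iterate σ v k) ⟩
    suc (toℕ (iterate σ v k)) % n   ≡⟨ cong (λ x → suc x % n) (toℕ-iterate-σ v k) ⟩
    suc ((k + toℕ v) % n) % n       ≡⟨ suc-% (k + toℕ v) ⟩
    suc (k + toℕ v) % n             ∎
    where open ≡-Reasoning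

  σ-order : ∀ v → iterate σ v n ≡ v
  σ-order v = toℕ-injective (begin
    toℕ (iterate σ v n)  ≡⟨ toℕ-iterate-σ v n ⟩
    (n + toℕ v) % n      ≡⟨ %-congˡ (+-comm n (toℕ v)) ⟩
    (toℕ v + n) % n      ≡⟨ [m+n]%n≡m%n (toℕ v) n ⟩
    toℕ v % n            ≡⟨ m<n⇒m%n≡m (toℕ<n v) ⟩
    toℕ v                ∎)
    where open ≡-Reasoning

  τσ : ∀ v → τ (σ v) ≡ v
  τσ v = trans (cong (iterate σ v) (suc-pred n)) (σ-order v)

  στ : ∀ v → σ (τ v) ≡ v
  στ v = trans (sym (iterate-suc σ v (pred n))) (τσ v)

  -- As `j + toℕ v` is below `n + n`, reduction modulo `n` subtracts `n` at most once; a return to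
  -- `v` would force `j` to be 0 or `n`.
  σ-aperiodic : ∀ v {j} → 0 < j → j < n → iterate σ v j ≢ v
  σ-aperiodic v {j} 0<j j<n eq with j + toℕ v <? n | trans (sym (toℕ-iterate-σ v j)) (cong toℕ eq)
  ... | yes lt | j+v%n≡v = <⇒≢ (m<n+m (toℕ v) 0<j) (sym (trans (sym (m<n⇒m%n≡m lt)) j+v%n≡v))
  ... | no ¬lt | j+v%n≡v = <⇒≢ j<n (+-cancelʳ-≡ (toℕ v) j n (begin
    j + toℕ v            ≡⟨ sym (m∸n+n≡m n≤) ⟩
    j + toℕ v ∸ n + n    ≡⟨ cong (_+ n) (sym (m<n⇒m%n≡m ∸<n)) ⟩
    (j + toℕ v ∸ n) % n + n ≡⟨ cong (_+ n) (m≤n⇒[n∸m]%m≡n%m n≤) ⟩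
    (j + toℕ v) % n + n  ≡⟨ cong (_+ n) j+v%n≡v ⟩
    toℕ v + n            ≡⟨ +-comm (toℕ v) n ⟩
    n + toℕ v            ∎))
    where
    open ≡-Reasoning
    n≤ : n ≤ j + toℕ v
    n≤ = ≮⇒≥ ¬lt
    ∸<n : j + toℕ v ∸ n < n
    ∸<n = +-cancelʳ-< n _ n (subst (_< n + n) (sym (m∸n+n≡m n≤)) (+-mono-< j<n (toℕ<n v)))

  σ-transitive : ∀ s v → ∃[ a ] a < n × iterate σ s a ≡ v
  -- `k` is the offset from `s` to `v` with `n` added, which keeps the subtraction from truncating.
  σ-transitive s v = k % n , m%n<n k n , toℕ-injective (begin
    toℕ (iterate σ s (k % n))   ≡⟨ toℕ-iterate-σ s (k % n) ⟩
    (k % n + toℕ s) % n         ≡⟨ cong (λ x → (k % n + x) % n) (sym (m<n⇒m%n≡m (toℕ<n s))) ⟩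
    (k % n + toℕ s % n) % n     ≡⟨ sym (%-distribˡ-+ k (toℕ s) n) ⟩
    (toℕ v + (n ∸ toℕ s) + toℕ s) % n  ≡⟨ %-congˡ (+-assoc (toℕ v) (n ∸ toℕ s) (toℕ s)) ⟩
    (toℕ v + (n ∸ toℕ s + toℕ s)) % n  ≡⟨ cong (λ x → (toℕ v + x) % n) (m∸n+n≡m (<⇒≤ (toℕ<n s))) ⟩
    (toℕ v + n) % n             ≡⟨ [m+n]%n≡m%n (toℕ v) n ⟩
    toℕ v % n                   ≡⟨ m<n⇒m%n≡m (toℕ<n v) ⟩
    toℕ v                       ∎)
    where
    open ≡-Reasoning
    k = toℕ v + (n ∸ toℕ s)

  -- Each further `τ` cancels one `σ` of the full turn `σ-order`. This identifies the endpoints of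
  -- the two directions.
  iterate-τ : ∀ s a b → a + b ≡ n → iterate τ s b ≡ iterate σ s a
  iterate-τ s a zero    a+b≡n rewrite trans (sym (+-identityʳ a)) a+b≡n = sym (σ-order s)
  iterate-τ s a (suc b) a+b≡n = begin
    iterate τ s (suc b)       ≡⟨ iterate-suc τ s b ⟩
    τ (iterate τ s b)         ≡⟨ cong τ (iterate-τ s (suc a) b (trans (sym (+-suc a b)) a+b≡n)) ⟩
    τ (iterate σ s (suc a))   ≡⟨ cong τ (iterate-suc σ s a) ⟩
    τ (σ (iterate σ s a))     ≡⟨ τσ (iterate σ s a) ⟩
    iterate σ s a             ∎
    where open ≡-Reasoning

  τ-aperiodic : ∀ v {j} → 0 < j → j < n → iterate τ v j ≢ v
  τ-aperiodic v {j} 0<j j<n eq = σ-aperiodic v (m<n⇒0<n∸m j<n) (∸-monoʳ-< 0<j (<⇒≤ j<n))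
    (trans (sym (iterate-τ v (n ∸ j) j (m∸n+n≡m (<⇒≤ j<n)))) eq)

  successor-σ : ∀ v → CyclicSuccessor v (σ v)
  successor-σ v with m≤n⇒m<n∨m≡n (toℕ<n v)
  ... | inj₁ lt = inj₁ (trans (toℕ-σ v) (m<n⇒m%n≡m lt))
  ... | inj₂ eq = inj₂ (eq , trans (toℕ-σ v) (trans (%-congˡ eq) (n%n≡0 n)))

  successor⇒≡σ : ∀ {u v} → CyclicSuccessor u v → v ≡ σ u
  successor⇒≡σ {u} {v} (inj₁ v≡1+u) = toℕ-injective (trans v≡1+u
    (sym (trans (toℕ-σ u) (m<n⇒m%n≡m (subst (_< n) v≡1+u (toℕ<n v))))))
  successor⇒≡σ {u} {v} (inj₂ (1+u≡n , v≡0)) = toℕ-injective (trans v≡0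
    (sym (trans (toℕ-σ u) (trans (%-congˡ 1+u≡n) (n%n≡0 n)))))

  adjacent-σ : ∀ v → cycleAdj v (σ v)
  adjacent-σ v = inj₁ (successor-σ v)

  adjacent-τ : ∀ v → cycleAdj v (τ v)
  adjacent-τ v = inj₂ (subst (CyclicSuccessor (τ v)) (στ v) (successor-σ (τ v)))

-- Temporal distances in the cycle.

module TemporalCycle {n p : ℕ} (3≤n : 3 ≤ n) (ℓ : Labeling (cycle n 3≤n))
                     (periodic : IsPeriodic1Labeling p ℓ) where

  private instance
    n≢0 : NonZero n
    n≢0 = >-nonZero (≤-trans z<s 3≤n)

  open Rotation {n}
  open Labeling ℓ

  𝒞 : TemporalGraph n
  𝒞 = ⟨ cycle n 3≤n , ℓ ⟩

  module Cw  = Ray {p = p} 𝒞 periodic σ adjacent-σ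
  module Ccw = Ray {p = p} 𝒞 periodic τ adjacent-τ

  -- The distance from s to σᵃ s, which is also τᵇ s when a + b ≡ n.
  clock : Fin n → ℕ → ℕ → ℕ
  clock s a b = Cw.arrive s 0 a ⊓ Ccw.arrive s 0 b

  -- An invariant of all time-respecting walks from s, so that the shape of the
  -- paths in a cycle never has to be analysed.
  Bounded : Fin n → Fin n → ℕ → Set
  Bounded s x t = ∀ a b → a + b ≡ n → x ≡ iterate σ s a → clock s a b ≤ t

  bounded-start : ∀ s → Bounded s s 0
  bounded-start s zero    b       _     _    = z≤n
  -- The start seen as a full clockwise turn: the counterclockwise arrival is 0.
  bounded-start s (suc a) zero    _     _    = ≤-reflexive (⊓-zeroʳ (Cw.arrive s 0 (suc a)))
  bounded-start s (suc a) (suc b) a+b≡n s≡σᵃ =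
    contradiction (sym s≡σᵃ) (σ-aperiodic s z<s (subst (suc a <_) a+b≡n (m<m+n (suc a) z<s)))

  -- If the bound at `x` comes from the direction of the new edge, the earliest crossing is no later
  -- than `u`. If it comes from the opposite direction, that ray had already met `y` before `x`.
  bounded-step : ∀ {s x y t u} → cycleAdj x y → times x y u → t < u → Bounded s x t → Bounded s y u
  bounded-step {s} {x} {y} {t} {u} (inj₁ x→y) u∈ t<u bound (suc a) b a+b≡n y≡σᵃ = goal
    where
    x≡ : x ≡ iterate σ s a
    x≡ = begin
      x                          ≡⟨ sym (τσ x) ⟩
      τ (σ x)                    ≡⟨ cong τ (sym (successor⇒≡σ x→y)) ⟩
      τ y                        ≡⟨ cong τ (trans y≡σᵃ (iterate-suc σ s a)) ⟩
      τ (σ (iterate σ s a))      ≡⟨ τσ (iterate σ s a) ⟩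
      iterate σ s a              ∎
      where open ≡-Reasoning
    cw : Cw.arrive s 0 a < u → Cw.arrive s 0 (suc a) ≤ u
    cw lt rewrite Cw.arrive-suc s 0 a | sym x≡ =
      Cw.crossing-least (subst (λ z → times x z u) (successor⇒≡σ x→y) u∈) lt
    goal : clock s (suc a) b ≤ u
    goal with ⊓-sel (Cw.arrive s 0 a) (Ccw.arrive s 0 (suc b))
       | bound a (suc b) (trans (+-suc a b) a+b≡n) x≡
    ... | inj₁ sel | le = ≤-trans (m⊓n≤m _ _) (cw (≤-<-trans (subst (_≤ t) sel le) t<u))
    ... | inj₂ sel | le = ≤-trans (m⊓n≤n _ _)
      (<⇒≤ (<-trans (Ccw.arrive-<-suc s 0 b) (≤-<-trans (subst (_≤ t) sel le) t<u)))
  -- Here `y` is `s`, with clock 0.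
  bounded-step (inj₁ _) _ _ _ zero b _ _ = z≤n
  bounded-step {s} (inj₂ _) _ _ _ a zero _ _ = ≤-trans (m⊓n≤n (Cw.arrive s 0 a) 0) z≤n
  bounded-step {s} {x} {y} {t} {u} (inj₂ y→x) u∈ t<u bound a (suc b) a+b≡n y≡σᵃ = goal
    where
    x≡ : x ≡ iterate σ s (suc a)
    x≡ = trans (successor⇒≡σ y→x) (trans (cong σ y≡σᵃ) (sym (iterate-suc σ s a)))
    1+a+b≡n : suc a + b ≡ n
    1+a+b≡n = trans (sym (+-suc a b)) a+b≡n
    ccw : Ccw.arrive s 0 b < u → Ccw.arrive s 0 (suc b) ≤ u
    ccw lt rewrite Ccw.arrive-suc s 0 b | iterate-τ s (suc a) b 1+a+b≡n | sym x≡ =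
      Ccw.crossing-least (subst (λ z → times x z u)
        (trans (sym (τσ y)) (cong τ (sym (successor⇒≡σ y→x)))) u∈) lt
    goal : clock s a (suc b) ≤ u
    goal with ⊓-sel (Cw.arrive s 0 (suc a)) (Ccw.arrive s 0 b) | bound (suc a) b 1+a+b≡n x≡
    ... | inj₁ sel | le = ≤-trans (m⊓n≤m _ _)
      (<⇒≤ (<-trans (Cw.arrive-<-suc s 0 a) (≤-<-trans (subst (_≤ t) sel le) t<u)))
    ... | inj₂ sel | le = ≤-trans (m⊓n≤n (Cw.arrive s 0 a) _)
      (ccw (≤-<-trans (subst (_≤ t) sel le) t<u))

  bounded-walk : ∀ {s x v t} (w : Walk 𝒞 x v) ts →
    Pointwise (λ u (x , y) → times x y u) ts (edges 𝒞 w) →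
    Linked _<_ (t ∷ ts) → Bounded s x t → Bounded s v (fromMaybe t (last ts))
  bounded-walk ε       []       []       _           bound = bound
  bounded-walk {t = t} (e ◅ w) (u ∷ ts) (u∈ ∷ av) (t<u ∷ inc) bound rewrite last-∷ t u ts =
    bounded-walk w ts av inc (bounded-step e u∈ t<u bound)

  times-positive : ∀ {x y u} → cycleAdj x y → times x y u → 0 < u
  times-positive e u∈ with periodic e
  ... | i , 1≤i , _ , ⊆ , _ with ⊆ u∈
  ...   | k , refl = ≤-trans 1≤i (m≤m+n i (k * p))

  increasing-from-0 : ∀ {x v} (w : Walk 𝒞 x v) ts →
    Pointwise (λ u (x , y) → times x y u) ts (edges 𝒞 w) → Linked _<_ ts → Linked _<_ (0 ∷ ts)
  increasing-from-0 ε       []       []       _   = [-]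
  increasing-from-0 (e ◅ _) (u ∷ ts) (u∈ ∷ _) inc = times-positive e u∈ ∷ inc

  bounded-journey : ∀ {s v} (J : Journey 𝒞 s v) → Bounded s v (Journey.arrival J)
  -- Starting the walk at time 0 makes the default of `bounded-walk` agree with the one in
  -- `arrival`; labels being positive, 0 may precede the steps.
  bounded-journey {s} J = bounded-walk walk steps available
    (increasing-from-0 walk steps available increasing) (bounded-start s)
    where open Journey J

  journey : ∀ s a b → a < n → a + b ≡ n →
    ∃[ J ] Journey.arrival {𝒢 = 𝒞} {s} {iterate σ s a} J ≡ clock s a b
  -- Now `b` is `n`, so the counterclockwise walk would close up; the trivial journey attains the
  -- clock 0.
  journey s zero    b       a<n a+b≡n = Cw.journey σ-aperiodic s a<n
  journey s (suc a) b a<n a+b≡n with ≤-total (Cw.arrive s 0 (suc a)) (Ccw.arrive s 0 b)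
  ... | inj₁ le rewrite m≤n⇒m⊓n≡m le = Cw.journey σ-aperiodic s a<n
  ... | inj₂ ge rewrite m≥n⇒m⊓n≡n ge =
    subst (λ v → ∃[ J ] Journey.arrival {𝒢 = 𝒞} {s} {v} J ≡ Ccw.arrive s 0 b)
      (iterate-τ s (suc a) b a+b≡n)
      (Ccw.journey τ-aperiodic s (subst (b <_) a+b≡n (m<n+m b z<s)))

  distance : ∀ s a b → a < n → a + b ≡ n → TemporalDistance 𝒞 s (iterate σ s a) [ clock s a b ]
  distance s a b a<n a+b≡n = journey s a b a<n a+b≡n , λ J → bounded-journey J a b a+b≡n refl

  -- Separation of vertices by `s` and `σ s`.

  module _ (s : Fin n) (descends : Cw.label (σ s) ≤ Cw.label s) where

    separated-< : ∀ {a b a′ b′} → a < b → b < n → a + a′ ≡ n → b + b′ ≡ n →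
      Distinguishes 𝒞 s (iterate σ s a) (iterate σ s b) ⊎
      Distinguishes 𝒞 (σ s) (iterate σ s a) (iterate σ s b)
    separated-< {a} {b} {a′} {b′} a<b b<n a+a′≡n b+b′≡n
      -- In each direction the vertex met first is reached first, so a strict inequality here beats
      -- both routes to the other vertex.
      with <-cmp (Cw.arrive s 0 a) (Ccw.arrive s 0 b′)
    ... | tri< lt _ _ = inj₁ (<⇒Distinguishes 𝒞
      (distance s a a′ (<-trans a<b b<n) a+a′≡n) (distance s b b′ b<n b+b′≡n)
      (m<n⇒m⊓o<n _ (⊓-pres-m< (Cw.arrive-mono-< s 0 a<b) lt)))
    ... | tri> _ _ gt = inj₁ (Distinguishes-sym 𝒞 (<⇒Distinguishes 𝒞
      (distance s b b′ b<n b+b′≡n) (distance s a a′ (<-trans a<b b<n) a+a′≡n)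
      (m<n⇒o⊓m<n (Cw.arrive s 0 b) (⊓-pres-m< gt (Ccw.arrive-mono-< s 0 b′<a′)))))
      where
      b′<a′ : b′ < a′
      b′<a′ = +-cancelˡ-< b b′ a′ (subst (_< b + a′) (trans a+a′≡n (sym b+b′≡n)) (+-monoˡ-< a′ a<b))
    -- A tie is impossible at `s` itself: its arrival is 0, while `b < n` leaves at least one
    -- counterclockwise edge.
    separated-< {zero} {b} {a′} {b′} _ b<n _ b+b′≡n | tri≈ _ eq _ =
      contradiction eq (<⇒≢ (Ccw.arrive-mono-< s 0 0<b′))
      where
      0<b′ : 0 < b′
      0<b′ = +-cancelˡ-< b 0 b′ (subst₂ _<_ (sym (+-identityʳ b)) (sym b+b′≡n) b<n)
    separated-< {suc a} {suc b} {a′} {b′} a<b b<n a+a′≡n b+b′≡n | tri≈ _ eq _ =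
      inj₂ (<⇒Distinguishes 𝒞
        -- Seen from `σ s`, each vertex is one edge nearer clockwise and one farther
        -- counterclockwise.
        (distance (σ s) a (suc a′) (<-trans (n<1+n a) (<-trans a<b b<n)) (trans (+-suc a a′) a+a′≡n))
        (distance (σ s) b (suc b′) (<-trans (n<1+n b) b<n) (trans (+-suc b b′) b+b′≡n))
        (m<n⇒m⊓o<n _ (⊓-pres-m< (Cw.arrive-mono-< (σ s) 0 (s<s⁻¹ a<b)) (begin-strict
          Cw.arrive (σ s) 0 a                                  <⟨ Cw.arrive-σ-< s a descends ⟩
          -- A counterclockwise journey from `σ s` first crosses back to `s`, so it leaves `s` no
          -- earlier than time 0.
          Cw.arrive s 0 (suc a)                                ≡⟨ eq ⟩
          Ccw.arrive s 0 b′                                    ≤⟨ Ccw.arrive-mono-≤ s b′ z≤n ⟩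
          Ccw.arrive s (Ccw.crossing (σ s) 0) b′
            ≡⟨ cong (λ v → Ccw.arrive v (Ccw.crossing (σ s) 0) b′) (sym (τσ s)) ⟩
          Ccw.arrive (σ s) 0 (suc b′)                          ∎))))
      where open ≤-Reasoning

    separated : ∀ u v → u ≢ v → Distinguishes 𝒞 s u v ⊎ Distinguishes 𝒞 (σ s) u v
    separated u v u≢v with σ-transitive s u | σ-transitive s v
    ... | a , a<n , refl | b , b<n , refl with <-cmp a b
    ...   | tri< a<b _ _ = separated-< a<b b<n (m+[n∸m]≡n (<⇒≤ a<n)) (m+[n∸m]≡n (<⇒≤ b<n))
    ...   | tri≈ _ refl _ = contradiction refl u≢v
    ...   | tri> _ _ b<a = Sum.map (Distinguishes-sym 𝒞) (Distinguishes-sym 𝒞)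
      (separated-< b<a a<n (m+[n∸m]≡n (<⇒≤ b<n)) (m+[n∸m]≡n (<⇒≤ a<n)))

  -- The minimum size of a resolving set.

  distanceTo : ∀ s v → ∃[ t ] TemporalDistance 𝒞 s v [ t ]
  distanceTo s v with σ-transitive s v
  ... | a , a<n , refl = _ , distance s a (n ∸ a) a<n (m+[n∸m]≡n (<⇒≤ a<n))

  dist : Fin n → Fin n → ℕ
  dist s v = proj₁ (distanceTo s v)

  journeyTo : ∀ s v → Journey 𝒞 s v
  journeyTo s v = proj₁ (proj₁ (proj₂ (distanceTo s v)))

  Distinguishes⇒dist≢ : ∀ {s u v} → Distinguishes 𝒞 s u v → dist s u ≢ dist s v
  Distinguishes⇒dist≢ {s} {u} {v} (d , e , du , dv , d≢e) eq = d≢e (begin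
    d            ≡⟨ TemporalDistance-unique 𝒞 (proj₂ (distanceTo s u)) d du ⟩
    [ dist s u ] ≡⟨ cong [_] eq ⟩
    [ dist s v ] ≡⟨ sym (TemporalDistance-unique 𝒞 (proj₂ (distanceTo s v)) e dv) ⟩
    e            ∎)
    where open ≡-Reasoning

  dist≢⇒Distinguishes : ∀ {s u v} → dist s u ≢ dist s v → Distinguishes 𝒞 s u v
  dist≢⇒Distinguishes {s} {u} {v} d≢e =
    _ , _ , proj₂ (distanceTo s u) , proj₂ (distanceTo s v) , d≢e ∘ []-injective

  -- Stated through the natural numbers `dist`, all distances being finite, so that it is decidable.
  Resolving : Fin n → Set
  Resolving s = ∀ u v → u ≢ v → dist s u ≢ dist s v

  resolving? : ∀ s → Dec (Resolving s)
  resolving? s = Fin.all? λ u → Fin.all? λ v → ¬? (u Fin.≟ v) →-dec ¬? (dist s u ≟ dist s v)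

  1≤∣resolving∣ : ∀ R → IsTemporalResolvingSet 𝒞 R → 1 ≤ ∣ R ∣
  1≤∣resolving∣ R res = x∈p⇒1≤∣p∣ (proj₁ (proj₂ (IsTemporalResolvingSet.reaches res v₀)))
    where
    v₀ : Fin n
    v₀ = 0 mod n

  -- In a resolving set of fewer than two vertices, the one that reaches a given vertex is the only
  -- member, so it separates all pairs alone.
  2≤∣resolving∣ : ¬ (∃[ s ] Resolving s) → ∀ R → IsTemporalResolvingSet 𝒞 R → 2 ≤ ∣ R ∣
  2≤∣resolving∣ none R res with 2 ≤? ∣ R ∣
  ... | yes 2≤ = 2≤
  ... | no ¬2≤ with IsTemporalResolvingSet.reaches res (0 mod n)
  ...   | s , s∈R , _ = contradiction (s , resolving-s) none
    where
    resolving-s : Resolving s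
    resolving-s u v u≢v with IsTemporalResolvingSet.resolves res u v u≢v
    ... | s′ , s′∈R , D with s Fin.≟ s′
    ...   | yes refl = Distinguishes⇒dist≢ D
    ...   | no s≢s′  = contradiction (x≢y⇒2≤∣p∣ s∈R s′∈R s≢s′) ¬2≤

  singleton-resolving : ∀ {s} → Resolving s → IsTemporalResolvingSet 𝒞 ⁅ s ⁆
  singleton-resolving {s} res = record
    { reaches  = λ v → s , x∈⁅x⁆ s , journeyTo s v
    ; resolves = λ u v u≢v → s , x∈⁅x⁆ s , dist≢⇒Distinguishes (res u v u≢v)
    }

  pair-resolving : ∀ s → Cw.label (σ s) ≤ Cw.label s → IsTemporalResolvingSet 𝒞 (⁅ s ⁆ ∪ ⁅ σ s ⁆)
  pair-resolving s descends = record
    { reaches  = λ v → s , s∈ , journeyTo s v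
    ; resolves = λ u v u≢v → Sum.[ (λ D → s , s∈ , D) , (λ D → σ s , σs∈ , D) ]′
                               (separated s descends u v u≢v)
    }
    where
    s∈ : s ∈ ⁅ s ⁆ ∪ ⁅ σ s ⁆
    s∈ = x∈p∪q⁺ (inj₁ (x∈⁅x⁆ s))
    σs∈ : σ s ∈ ⁅ s ⁆ ∪ ⁅ σ s ⁆
    σs∈ = x∈p∪q⁺ (inj₂ (x∈⁅x⁆ (σ s)))

  -- The minimum must be exhibited constructively: a finite search for a single resolving vertex
  -- decides between 1 and 2.
  dimension : ∃[ m ] IsTemporalMetricDimension 𝒞 m × 1 ≤ m × m ≤ 2
  dimension with Fin.any? resolving?
  ... | yes (s , res) = 1
    , ((⁅ s ⁆ , singleton-resolving res , ∣⁅x⁆∣≡1 s) , 1≤∣resolving∣) , s≤s z≤n , s≤s z≤n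
  ... | no none with Cw.descent (0 mod n)
  ...   | s , descends = 2
    -- The pair has exactly two elements: at most by subadditivity, at least because it is itself
    -- resolving.
    , ((⁅ s ⁆ ∪ ⁅ σ s ⁆ , pair-resolving s descends , ≤-antisym ∣pair∣≤2
         (2≤∣resolving∣ none _ (pair-resolving s descends))) , 2≤∣resolving∣ none)
    , s≤s z≤n , ≤-refl
    where
    ∣pair∣≤2 : ∣ ⁅ s ⁆ ∪ ⁅ σ s ⁆ ∣ ≤ 2
    ∣pair∣≤2 = ≤-trans (∣p∪q∣≤∣p∣+∣q∣ ⁅ s ⁆ ⁅ σ s ⁆)
      (≤-reflexive (cong₂ _+_ (∣⁅x⁆∣≡1 s) (∣⁅x⁆∣≡1 (σ s))))

theorem12 : ∀ (p : ℕ) → 1 ≤ p → ∀ (n : ℕ) (3≤n : 3 ≤ n) (ℓ : Labeling (cycle n 3≤n)) →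
    IsPeriodic1Labeling p ℓ →
    ∃[ m ] IsTemporalMetricDimension ⟨ cycle n 3≤n , ℓ ⟩ m × 1 ≤ m × m ≤ 2
theorem12 p _ n 3≤n ℓ periodic = TemporalCycle.dimension {p = p} 3≤n ℓ periodic
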